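{- Let $p>3$ be a prime, let $G$ be the additive group $(\mathbb{Z}/p\mathbb{Z})^2$, and let $S_2=\{(x,x^2): x\in\mathbb{Z}/p\mathbb{Z}\}\subseteq G$. Then the cop number of the directed Cayley graph $\mathrm{Cay}(G,S_2)$ is equal to $|S_2|=p=\sqrt{|G|}$.
   Context: Cops and robbers on a finite strongly connected digraph: first each cop chooses a starting vertex, then the robber chooses a starting vertex. Then cop turns and robber turns alternate, starting with a cop turn. On a cop turn each cop either stays where it is or moves along an arc, in the direction of the arc, to an out-neighbour; on a robber turn the robber does likewise. Several cops may share a vertex, and all players have full information. The cops win if at some point a cop shares a vertex with the robber; the robber wins if this never happens. The cop number is the minimum number of cops for which the cops have a winning strategy. $\mathrm{Cay}(G,S_2)$ is the digraph with vertex set $G$ containing the arc from $u$ to $v$ iff $v-u\in S_2$. Here $0_G\in S_2$ is allowed: choosing the move $0_G$ simply means staying in place, so the game is the same as on the digraph with connection set $S_2\setminus\{0_G\}$. The set $S_2$ generates $G$. -}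

module Defs where

open import Algebra.Core using (Op₁; Op₂)
open import Algebra.Structures using (IsAbelianGroup; IsCommutativeRing)
open import Data.Fin using (Fin; toℕ)
open import Data.Fin.Properties using (toℕ-fromℕ<; toℕ-injective; toℕ<n)
open import Data.List using (List; []; _∷_)
open import Data.Nat using (ℕ; zero; suc; _+_; _*_; _∸_; _≤_; NonZero; >-nonZero⁻¹)
open import Data.Nat.DivMod using (_%_; _mod_; m%n<n; m<n⇒m%n≡m; n%n≡0; %-distribˡ-+; %-distribˡ-*)
open import Data.Nat.Properties using (+-assoc; +-comm; *-assoc; *-comm; *-identityʳ; *-distribˡ-+; m∸n+n≡m; <⇒≤)
open import Data.Product using (_×_; _,_; ∃-syntax)
open import Data.Sum using (_⊎_)
open import Function using (_⇔_)
open import Function.Definitions using (Injective)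
open import Level using (0ℓ)
open import Relation.Binary using (Rel)
open import Relation.Binary.PropositionalEquality using (_≡_; sym; trans; cong; cong₂; isEquivalence; module ≡-Reasoning)
open import Relation.Unary using (Pred)

-- Cardinality of a subset.  The enumeration takes values in A rather than in
-- Σ A P, so different proofs of P a are not counted separately.
HasCardinality : {A : Set} → Pred A 0ℓ → ℕ → Set
HasCardinality {A} P n =
  ∃[ f ] (Injective {A = Fin n} {B = A} _≡_ _≡_ f × (∀ a → P a ⇔ (∃[ i ] f i ≡ a)))

record Digraph : Set₁ where
  field
    Vertex : Set
    Arc    : Rel Vertex 0ℓ

Cay : {A : Set} {_∙_ : Op₂ A} {ε : A} {_⁻¹ : Op₁ A} →
      IsAbelianGroup _≡_ _∙_ ε _⁻¹ → Pred A 0ℓ → Digraph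
Cay {A} {_∙_} {_} {_⁻¹} _ S = record
  { Vertex = A
  ; Arc    = λ u v → S (v ∙ (u ⁻¹))
  }

module Game (D : Digraph) where
  open Digraph D

  Step : Rel Vertex 0ℓ
  Step u v = u ≡ v ⊎ Arc u v

  -- `position h i` is the vertex of cop i after `length h` cop turns, where h
  -- lists the robber's positions at those turns, most recent first; thus
  -- `position []` is the initial placement.  The cops' own earlier positions
  -- are determined by the strategy and the tails of h, so this is full
  -- information.
  record CopStrategy (k : ℕ) : Set where
    field
      position : List Vertex → Fin k → Vertex
      legal    : ∀ h r i → Step (position h i) (position (r ∷ h) i)

  -- r t is the robber's position after t robber turns.
  RobberPlay : (ℕ → Vertex) → Set
  RobberPlay r = ∀ t → Step (r t) (r (suc t))

  seen : (ℕ → Vertex) → ℕ → List Vertex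
  seen r zero    = []
  seen r (suc t) = r t ∷ seen r t

  -- Capture is checked both just after the robber's placement or turn and just
  -- after the following cop turn.
  Captures : ∀ {k} → CopStrategy k → (ℕ → Vertex) → Set
  Captures σ r = ∃[ t ] ∃[ i ] (position (seen r t) i ≡ r t ⊎ position (seen r (suc t)) i ≡ r t)
    where open CopStrategy σ

  CopsWin : ℕ → Set
  CopsWin k = ∃[ σ ] (∀ r → RobberPlay r → Captures {k} σ r)

IsCopNumber : Digraph → ℕ → Set
IsCopNumber D k = CopsWin k × (∀ m → CopsWin m → k ≤ m)
  where open Game D

module ℤMod (n : ℕ) .{{_ : NonZero n}} where

  infixl 6 _⊕_
  infixl 7 _⊗_

  _⊕_ _⊗_ : Op₂ (Fin n)
  x ⊕ y = (toℕ x + toℕ y) mod n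
  x ⊗ y = (toℕ x * toℕ y) mod n

  ⊖_ : Op₁ (Fin n)
  ⊖ x = (n ∸ toℕ x) mod n

  0ₙ 1ₙ : Fin n
  0ₙ = 0 mod n
  1ₙ = 1 mod n

  toℕ-mod : ∀ a → toℕ (a mod n) ≡ a % n
  toℕ-mod a = toℕ-fromℕ< (m%n<n a n)

  mod-cong : ∀ {a b} → a % n ≡ b % n → a mod n ≡ b mod n
  mod-cong {a} {b} eq = toℕ-injective (trans (toℕ-mod a) (trans eq (sym (toℕ-mod b))))

  mod-toℕ : ∀ x → toℕ x mod n ≡ x
  mod-toℕ x = toℕ-injective (trans (toℕ-mod (toℕ x)) (m<n⇒m%n≡m (toℕ<n x)))

  mod-+ : ∀ a b → (a mod n) ⊕ (b mod n) ≡ (a + b) mod n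
  mod-+ a b = mod-cong (trans (cong₂ (λ x y → (x + y) % n) (toℕ-mod a) (toℕ-mod b))
                              (sym (%-distribˡ-+ a b n)))

  mod-* : ∀ a b → (a mod n) ⊗ (b mod n) ≡ (a * b) mod n
  mod-* a b = mod-cong (trans (cong₂ (λ x y → (x * y) % n) (toℕ-mod a) (toℕ-mod b))
                              (sym (%-distribˡ-* a b n)))

  ⊕-comm : ∀ x y → x ⊕ y ≡ y ⊕ x
  ⊕-comm x y = cong (_mod n) (+-comm (toℕ x) (toℕ y))

  ⊗-comm : ∀ x y → x ⊗ y ≡ y ⊗ x
  ⊗-comm x y = cong (_mod n) (*-comm (toℕ x) (toℕ y))

  ⊕-assoc : ∀ x y z → (x ⊕ y) ⊕ z ≡ x ⊕ (y ⊕ z)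
  ⊕-assoc x y z = begin
    (x ⊕ y) ⊕ z                         ≡⟨ cong ((x ⊕ y) ⊕_) (mod-toℕ z) ⟨
    (x ⊕ y) ⊕ (toℕ z mod n)             ≡⟨ mod-+ (toℕ x + toℕ y) (toℕ z) ⟩
    (toℕ x + toℕ y + toℕ z) mod n       ≡⟨ cong (_mod n) (+-assoc (toℕ x) (toℕ y) (toℕ z)) ⟩
    (toℕ x + (toℕ y + toℕ z)) mod n     ≡⟨ mod-+ (toℕ x) (toℕ y + toℕ z) ⟨
    (toℕ x mod n) ⊕ (y ⊕ z)             ≡⟨ cong (_⊕ (y ⊕ z)) (mod-toℕ x) ⟩
    x ⊕ (y ⊕ z)                         ∎
    where open ≡-Reasoning

  ⊗-assoc : ∀ x y z → (x ⊗ y) ⊗ z ≡ x ⊗ (y ⊗ z)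
  ⊗-assoc x y z = begin
    (x ⊗ y) ⊗ z                         ≡⟨ cong ((x ⊗ y) ⊗_) (mod-toℕ z) ⟨
    (x ⊗ y) ⊗ (toℕ z mod n)             ≡⟨ mod-* (toℕ x * toℕ y) (toℕ z) ⟩
    (toℕ x * toℕ y * toℕ z) mod n       ≡⟨ cong (_mod n) (*-assoc (toℕ x) (toℕ y) (toℕ z)) ⟩
    (toℕ x * (toℕ y * toℕ z)) mod n     ≡⟨ mod-* (toℕ x) (toℕ y * toℕ z) ⟨
    (toℕ x mod n) ⊗ (y ⊗ z)             ≡⟨ cong (_⊗ (y ⊗ z)) (mod-toℕ x) ⟩
    x ⊗ (y ⊗ z)                         ∎
    where open ≡-Reasoning

  ⊗-distribˡ-⊕ : ∀ x y z → x ⊗ (y ⊕ z) ≡ x ⊗ y ⊕ x ⊗ z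
  ⊗-distribˡ-⊕ x y z = begin
    x ⊗ (y ⊕ z)                             ≡⟨ cong (_⊗ (y ⊕ z)) (mod-toℕ x) ⟨
    (toℕ x mod n) ⊗ (y ⊕ z)                 ≡⟨ mod-* (toℕ x) (toℕ y + toℕ z) ⟩
    (toℕ x * (toℕ y + toℕ z)) mod n         ≡⟨ cong (_mod n) (*-distribˡ-+ (toℕ x) (toℕ y) (toℕ z)) ⟩
    (toℕ x * toℕ y + toℕ x * toℕ z) mod n   ≡⟨ mod-+ (toℕ x * toℕ y) (toℕ x * toℕ z) ⟨
    x ⊗ y ⊕ x ⊗ z                           ∎
    where open ≡-Reasoning

  ⊗-distribʳ-⊕ : ∀ x y z → (y ⊕ z) ⊗ x ≡ y ⊗ x ⊕ z ⊗ x
  ⊗-distribʳ-⊕ x y z = trans (⊗-comm (y ⊕ z) x)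
    (trans (⊗-distribˡ-⊕ x y z) (cong₂ _⊕_ (⊗-comm x y) (⊗-comm x z)))

  ⊕-identityˡ : ∀ x → 0ₙ ⊕ x ≡ x
  ⊕-identityˡ x = trans (cong (0ₙ ⊕_) (sym (mod-toℕ x))) (trans (mod-+ 0 (toℕ x)) (mod-toℕ x))

  ⊕-identityʳ : ∀ x → x ⊕ 0ₙ ≡ x
  ⊕-identityʳ x = trans (⊕-comm x 0ₙ) (⊕-identityˡ x)

  ⊗-identityʳ : ∀ x → x ⊗ 1ₙ ≡ x
  ⊗-identityʳ x = trans (cong (_⊗ 1ₙ) (sym (mod-toℕ x)))
    (trans (mod-* (toℕ x) 1) (trans (cong (_mod n) (*-identityʳ (toℕ x))) (mod-toℕ x)))

  ⊗-identityˡ : ∀ x → 1ₙ ⊗ x ≡ x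
  ⊗-identityˡ x = trans (⊗-comm 1ₙ x) (⊗-identityʳ x)

  ⊖-inverseˡ : ∀ x → (⊖ x) ⊕ x ≡ 0ₙ
  ⊖-inverseˡ x = begin
    (⊖ x) ⊕ x                    ≡⟨ cong ((⊖ x) ⊕_) (mod-toℕ x) ⟨
    (⊖ x) ⊕ (toℕ x mod n)        ≡⟨ mod-+ (n ∸ toℕ x) (toℕ x) ⟩
    (n ∸ toℕ x + toℕ x) mod n    ≡⟨ cong (_mod n) (m∸n+n≡m (<⇒≤ (toℕ<n x))) ⟩
    n mod n                      ≡⟨ mod-cong (trans (n%n≡0 n) (sym (m<n⇒m%n≡m (>-nonZero⁻¹ n)))) ⟩
    0ₙ                           ∎
    where open ≡-Reasoning

  ⊖-inverseʳ : ∀ x → x ⊕ (⊖ x) ≡ 0ₙ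
  ⊖-inverseʳ x = trans (⊕-comm x (⊖ x)) (⊖-inverseˡ x)

  ⊕-isAbelianGroup : IsAbelianGroup _≡_ _⊕_ 0ₙ ⊖_
  ⊕-isAbelianGroup = record
    { isGroup = record
      { isMonoid = record
        { isSemigroup = record
          { isMagma = record { isEquivalence = isEquivalence ; ∙-cong = cong₂ _⊕_ }
          ; assoc = ⊕-assoc
          }
        ; identity = ⊕-identityˡ , ⊕-identityʳ
        }
      ; inverse = ⊖-inverseˡ , ⊖-inverseʳ
      ; ⁻¹-cong = cong ⊖_
      }
    ; comm = ⊕-comm
    }

  ⊕-⊗-isCommutativeRing : IsCommutativeRing _≡_ _⊕_ _⊗_ ⊖_ 0ₙ 1ₙ
  ⊕-⊗-isCommutativeRing = record
    { isRing = record
      { +-isAbelianGroup = ⊕-isAbelianGroup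
      ; *-cong     = cong₂ _⊗_
      ; *-assoc    = ⊗-assoc
      ; *-identity = ⊗-identityˡ , ⊗-identityʳ
      ; distrib    = ⊗-distribˡ-⊕ , ⊗-distribʳ-⊕
      }
    ; *-comm = ⊗-comm
    }

  G : Set
  G = Fin n × Fin n

  _+ᴳ_ : Op₂ G
  (a , b) +ᴳ (c , d) = a ⊕ c , b ⊕ d

  0ᴳ : G
  0ᴳ = 0ₙ , 0ₙ

  -ᴳ_ : Op₁ G
  -ᴳ (a , b) = ⊖ a , ⊖ b

  G-isAbelianGroup : IsAbelianGroup _≡_ _+ᴳ_ 0ᴳ -ᴳ_
  G-isAbelianGroup = record
    { isGroup = record
      { isMonoid = record
        { isSemigroup = record
          { isMagma = record { isEquivalence = isEquivalence ; ∙-cong = cong₂ _+ᴳ_ }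
          ; assoc = λ (a , b) (c , d) (e , f) → cong₂ _,_ (⊕-assoc a c e) (⊕-assoc b d f)
          }
        ; identity = (λ (a , b) → cong₂ _,_ (⊕-identityˡ a) (⊕-identityˡ b))
                   , (λ (a , b) → cong₂ _,_ (⊕-identityʳ a) (⊕-identityʳ b))
        }
      ; inverse = (λ (a , b) → cong₂ _,_ (⊖-inverseˡ a) (⊖-inverseˡ b))
                , (λ (a , b) → cong₂ _,_ (⊖-inverseʳ a) (⊖-inverseʳ b))
      ; ⁻¹-cong = cong -ᴳ_
      }
    ; comm = λ (a , b) (c , d) → cong₂ _,_ (⊕-comm a c) (⊕-comm b d)
    }

  S₂ : Pred G 0ℓ
  S₂ g = ∃[ x ] g ≡ (x , x ⊗ x)

{-# OPTIONS --safe #-}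
module Submission where

-- Lower bound: the parabola meets each of its proper translates in at most one point, so a cop not
-- on the robber's vertex threatens at most one of the p vertices to which the robber can move.
--
-- Upper bound: assign cop i to the robber move (i , i²).  Cop i copies every other move, which
-- preserves its position relative to the robber.  When the robber plays (i , i²), the cop is free to
-- change that relative position by (i , i²) - (y , y²) for any y.  These differences generate G, so a
-- fixed plan brings the cop onto the robber after boundedly many such turns, and the robber must
-- exhaust some cop's bound.

open import Defs
open import Algebra.Bundles using (AbelianGroup; CommutativeRing)
open import Algebra.Core using (Op₁; Op₂)
open import Algebra.Definitions.RawMonoid using (sum)
import Algebra.Properties.AbelianGroup
import Algebra.Properties.CommutativeSemigroup
import Algebra.Properties.Ring
import Algebra.Solver.Ring.NaturalCoefficients.Default
open import Algebra.Structures using (IsCommutativeRing)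
open import Data.Fin using (Fin; zero; suc; toℕ; remQuot; combine)
open import Data.Fin.Properties using (_≟_; any?; ¬∀⟶∃¬; <⇒notInjective; toℕ<n; toℕ-injective; remQuot-combine; combine-remQuot)
open import Data.List using (List; []; _∷_)
open import Data.Nat using (ℕ; zero; suc; _+_; _*_; _>_; _^_; _≤_; _<_; _/_; _%_; z<s; s<s; s≤s⁻¹; +-0-rawMonoid)
open import Data.Nat.DivMod using (_mod_; m%n<n; m≡m%n+[m/n]*n; m<n⇒m%n≡m; [m+n]%n≡m%n)
open import Data.Nat.Divisibility using (_∣_; m%n≡0⇒n∣m; n∣m⇒m%n≡0)
open import Data.Nat.Primality using (Prime; prime⇒nonZero; prime⇒irreducible; euclidsLemma)
open import Data.Nat.Properties using (≤-refl; ≤-reflexive; <-≤-trans; ≤-<-trans; <⇒≤; ≮⇒≥; m≤n⇒m<n∨m≡n; +-mono-≤; +-mono-<-≤; +-mono-≤-<; *-identityʳ; *-comm; +-comm; *-suc; n<1+n)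
open import Data.Product using (_×_; _,_; ∃-syntax; proj₁; proj₂; uncurry)
open import Data.Product.Properties using (≡-dec)
open import Data.Sum using (inj₁; inj₂)
open import Function using (_∘_; mk⇔)
open import Level using (0ℓ)
open import Relation.Binary.Definitions using (DecidableEquality)
open import Relation.Binary.PropositionalEquality using (_≡_; _≢_; refl; sym; trans; cong; cong₂; subst; module ≡-Reasoning)
open import Relation.Nullary using (¬_; Dec; yes; no; contradiction)
open import Relation.Unary using (U)

-- Monotone sums and a pigeonhole principle.

sum-mono-≤ : ∀ {n} {f g : Fin n → ℕ} → (∀ i → f i ≤ g i) → sum +-0-rawMonoid f ≤ sum +-0-rawMonoid g
sum-mono-≤ {zero}  f≤g = ≤-refl
sum-mono-≤ {suc n} f≤g = +-mono-≤ (f≤g zero) (sum-mono-≤ (f≤g ∘ suc))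

sum-mono-< : ∀ {n} {f g : Fin n → ℕ} → (∀ i → f i ≤ g i) → ∀ j → f j < g j →
             sum +-0-rawMonoid f < sum +-0-rawMonoid g
sum-mono-< f≤g zero    fj<gj = +-mono-<-≤ fj<gj (sum-mono-≤ (f≤g ∘ suc))
sum-mono-< f≤g (suc j) fj<gj = +-mono-≤-< (f≤g zero) (sum-mono-< (f≤g ∘ suc) j fj<gj)

-- Pigeonhole: if every `x` had a blocker, choosing one for each would inject `Fin n` into `Fin m`,
-- since no `i` blocks two values. Decidability of `B` turns this refutation into a witness.
unblocked : ∀ {m n} → m < n → (B : Fin n → Fin m → Set) → (∀ x i → Dec (B x i)) →
            (∀ {x y} i → B x i → B y i → x ≡ y) → ∃[ x ] (∀ i → ¬ B x i)
unblocked {n = n} m<n B B? unique = proj₁ free , λ i b → proj₂ free (i , b)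
  where
  notAllBlocked : ¬ (∀ x → ∃[ i ] B x i)
  notAllBlocked blocker = <⇒notInjective {f = proj₁ ∘ blocker} m<n λ {x} {y} eq →
    unique _ (proj₂ (blocker x)) (subst (B y) (sym eq) (proj₂ (blocker y)))

  free : ∃[ x ] (¬ (∃[ i ] B x i))
  free = ¬∀⟶∃¬ n _ (λ x → any? (B? x)) notAllBlocked

-- Polynomial identities for the parabola.

module ParabolaIdentities {X : Set} {_⊕_ _⊗_ : Op₂ X} {⊖_ : Op₁ X} {0# 1# : X}
  (isCR : IsCommutativeRing _≡_ _⊕_ _⊗_ ⊖_ 0# 1#) where

  private
    R : CommutativeRing 0ℓ 0ℓ
    R = record { isCommutativeRing = isCR }

  open CommutativeRing R using (ring; commutativeSemiring)
  open Algebra.Properties.Ring ring using (-‿distribˡ-*; -‿distribʳ-*; -‿involutive; +-cancelˡ; +-cancelʳ)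
  open Algebra.Solver.Ring.NaturalCoefficients.Default commutativeSemiring

  -x*-x≡x*x : ∀ x → (⊖ x) ⊗ (⊖ x) ≡ x ⊗ x
  -x*-x≡x*x x = begin
    (⊖ x) ⊗ (⊖ x)  ≡⟨ -‿distribˡ-* x (⊖ x) ⟨
    ⊖ (x ⊗ (⊖ x))  ≡⟨ cong ⊖_ (-‿distribʳ-* x x) ⟨
    ⊖ (⊖ (x ⊗ x))  ≡⟨ -‿involutive (x ⊗ x) ⟩
    x ⊗ x          ∎
    where open ≡-Reasoning

  -- The squares of `x` cancel, leaving an equation linear in `x`; hence a proper translate meets
  -- the parabola at most once when 2 is invertible.
  translate-meets-parabola : ∀ {a b x} → (a ⊕ x) ⊗ (a ⊕ x) ≡ b ⊕ (x ⊗ x) → (a ⊗ a) ⊕ (a ⊗ (x ⊕ x)) ≡ b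
  translate-meets-parabola {a} {b} {x} eq = +-cancelʳ (x ⊗ x) _ _ (trans
    (solve 2 (λ a x → a :* a :+ a :* (x :+ x) :+ x :* x := (a :+ x) :* (a :+ x)) refl a x) eq)

  -- (A , B) is the robber's position relative to a cop.  The robber moves by (i , i²) and the cop by
  -- (y , y²), where y = i - u.  The shear C = B - 2Ai turns this into a step (u , -u²) independent of i.
  sheared-step : ∀ {c₁ c₂ r₁ r₂ A B C A′ B′ C′ y u i} →
    c₁ ⊕ A ≡ r₁ → c₂ ⊕ B ≡ r₂ → C ⊕ ((A ⊕ A) ⊗ i) ≡ B →
    (c₁ ⊕ y) ⊕ A′ ≡ r₁ ⊕ i → (c₂ ⊕ (y ⊗ y)) ⊕ B′ ≡ r₂ ⊕ (i ⊗ i) → C′ ⊕ ((A′ ⊕ A′) ⊗ i) ≡ B′ →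
    y ⊕ u ≡ i → A′ ≡ A ⊕ u × C′ ⊕ (u ⊗ u) ≡ C
  sheared-step {c₁} {c₂} {A = A} {C = C} {A′} {C′ = C′} {y} {u} refl refl refl e₁ e₂ refl refl
    with refl ← +-cancelˡ (c₁ ⊕ y) A′ (A ⊕ u) (trans e₁
           (solve 4 (λ c A y u → c :+ A :+ (y :+ u) := c :+ y :+ (A :+ u)) refl c₁ A y u))
    = refl , +-cancelˡ common _ _ (trans
        (solve 5 (λ c C A y u →
            c :+ y :* y :+ (A :+ A) :* (y :+ u) :+ (y :+ y) :* u :+ u :* u :+ (C :+ u :* u)
            := c :+ y :* y :+ (C :+ (A :+ u :+ (A :+ u)) :* (y :+ u))) refl c₂ C′ A y u)
        (trans e₂
        (solve 5 (λ c C A y u →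
            c :+ (C :+ (A :+ A) :* (y :+ u)) :+ (y :+ u) :* (y :+ u)
            := c :+ y :* y :+ (A :+ A) :* (y :+ u) :+ (y :+ y) :* u :+ u :* u :+ C) refl c₂ C A y u)))
    where
    -- Adding these terms to both sides of `C′ ⊕ (u ⊗ u) ≡ C` removes every subtraction, so what
    -- remains holds in any commutative semiring.
    common : X
    common = ((((c₂ ⊕ (y ⊗ y)) ⊕ ((A ⊕ A) ⊗ (y ⊕ u))) ⊕ ((y ⊕ y) ⊗ u)) ⊕ (u ⊗ u))

module OddPrime (p : ℕ) (pr : Prime p) (p>3 : p > 3) where

  private instance
    p≢0 = prime⇒nonZero pr

  open ℤMod p
  open ParabolaIdentities ⊕-⊗-isCommutativeRing

  private
    R : CommutativeRing 0ℓ 0ℓ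
    R = record { isCommutativeRing = ⊕-⊗-isCommutativeRing }

    𝔾 : AbelianGroup 0ℓ 0ℓ
    𝔾 = record { isAbelianGroup = G-isAbelianGroup }

  open CommutativeRing R using (ring; zeroˡ; zeroʳ) renaming (_-_ to _⊝_)
  open Algebra.Properties.Ring ring using (x[y-z]≈xy-xz)
    renaming (x∙y⁻¹≈ε⇒x≈y to x⊝y≡0⇒x≡y; x≈y⇒x∙y⁻¹≈ε to x≡y⇒x⊝y≡0; +-cancelˡ to ⊕-cancelˡ)
  module ℤₚ = Algebra.Properties.AbelianGroup (CommutativeRing.+-abelianGroup R)

  module 𝔾 where
    open AbelianGroup 𝔾 public
    open Algebra.Properties.AbelianGroup 𝔾 public
    open Algebra.Properties.CommutativeSemigroup commutativeSemigroup public using (xy∙z≈xz∙y)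
  open 𝔾 using (_-_)

  -- Cancellation and halving modulo `p`.

  p>1 : 1 < p
  p>1 = ≤-<-trans (z<s) p>3

  toℕ-0ₙ : toℕ 0ₙ ≡ 0
  toℕ-0ₙ = trans (toℕ-mod 0) (m<n⇒m%n≡m (<⇒≤ p>1))

  toℕ-1ₙ : toℕ 1ₙ ≡ 1
  toℕ-1ₙ = trans (toℕ-mod 1) (m<n⇒m%n≡m p>1)

  1ₙ≢0ₙ : 1ₙ ≢ 0ₙ
  1ₙ≢0ₙ eq with () ← trans (sym toℕ-1ₙ) (trans (cong toℕ eq) toℕ-0ₙ)

  p∣toℕ⇒≡0ₙ : ∀ {x} → p ∣ toℕ x → x ≡ 0ₙ
  p∣toℕ⇒≡0ₙ {x} p∣x = toℕ-injective (begin
    toℕ x      ≡⟨ m<n⇒m%n≡m (toℕ<n x) ⟨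
    toℕ x % p  ≡⟨ n∣m⇒m%n≡0 _ p p∣x ⟩
    0          ≡⟨ toℕ-0ₙ ⟨
    toℕ 0ₙ     ∎)
    where open ≡-Reasoning

  x⊗y≡0⇒y≡0 : ∀ {x y} → x ≢ 0ₙ → x ⊗ y ≡ 0ₙ → y ≡ 0ₙ
  x⊗y≡0⇒y≡0 {x} {y} x≢0 eq with euclidsLemma (toℕ x) (toℕ y) pr
    (m%n≡0⇒n∣m _ p (trans (sym (toℕ-mod _)) (trans (cong toℕ eq) toℕ-0ₙ)))
  ... | inj₁ p∣x = contradiction (p∣toℕ⇒≡0ₙ p∣x) x≢0
  ... | inj₂ p∣y = p∣toℕ⇒≡0ₙ p∣y

  ⊗-cancelˡ : ∀ {x y z} → x ≢ 0ₙ → x ⊗ y ≡ x ⊗ z → y ≡ z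
  ⊗-cancelˡ {x} {y} {z} x≢0 eq = x⊝y≡0⇒x≡y y z (x⊗y≡0⇒y≡0 x≢0
    (trans (x[y-z]≈xy-xz x y z) (x≡y⇒x⊝y≡0 eq)))

  p%2≡1 : p % 2 ≡ 1
  p%2≡1 with p % 2 in eq | m%n<n p 2
  ... | 1           | _ = refl
  ... | suc (suc _) | s<s (s<s ())
  ... | 0           | _ with prime⇒irreducible pr (m%n≡0⇒n∣m p 2 eq)
  ...   | inj₂ 2≡p = contradiction (subst (3 <_) (sym 2≡p) p>3) λ { (s<s (s<s ())) }

  -- As `p` is odd, the representative is `(p + 1) / 2`.
  ½ : Fin p
  ½ = suc (p / 2) mod p

  ½⊕½≡1 : ½ ⊕ ½ ≡ 1ₙ
  ½⊕½≡1 = begin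
    ½ ⊕ ½                            ≡⟨ mod-+ (suc (p / 2)) (suc (p / 2)) ⟩
    (suc (p / 2) + suc (p / 2)) mod p ≡⟨ cong (_mod p) lemma ⟩
    (1 + p) mod p                     ≡⟨ mod-cong ([m+n]%n≡m%n 1 p) ⟩
    1ₙ                                ∎
    where
    open ≡-Reasoning
    lemma : suc (p / 2) + suc (p / 2) ≡ 1 + p
    lemma = begin
      suc (p / 2) + suc (p / 2)  ≡⟨ cong (suc (p / 2) +_) (+-comm 0 (suc (p / 2))) ⟩
      2 * suc (p / 2)            ≡⟨ *-comm 2 (suc (p / 2)) ⟩
      suc (suc (p / 2 * 2))      ≡⟨ cong (λ r → suc (r + p / 2 * 2)) p%2≡1 ⟨
      suc (p % 2 + p / 2 * 2)    ≡⟨ cong suc (m≡m%n+[m/n]*n p 2) ⟨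
      1 + p                      ∎

  ½⊗[x⊕x]≡x : ∀ x → ½ ⊗ (x ⊕ x) ≡ x
  ½⊗[x⊕x]≡x x = begin
    ½ ⊗ (x ⊕ x)    ≡⟨ ⊗-distribˡ-⊕ ½ x x ⟩
    ½ ⊗ x ⊕ ½ ⊗ x  ≡⟨ ⊗-distribʳ-⊕ x ½ ½ ⟨
    (½ ⊕ ½) ⊗ x    ≡⟨ cong (_⊗ x) ½⊕½≡1 ⟩
    1ₙ ⊗ x         ≡⟨ ⊗-identityˡ x ⟩
    x              ∎
    where open ≡-Reasoning

  ½⊗x≡0⇒x≡0 : ∀ {x} → ½ ⊗ x ≡ 0ₙ → x ≡ 0ₙ
  ½⊗x≡0⇒x≡0 {x} eq = begin
    x              ≡⟨ ½⊗[x⊕x]≡x x ⟨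
    ½ ⊗ (x ⊕ x)    ≡⟨ ⊗-distribˡ-⊕ ½ x x ⟩
    ½ ⊗ x ⊕ ½ ⊗ x  ≡⟨ cong₂ _⊕_ eq eq ⟩
    0ₙ ⊕ 0ₙ        ≡⟨ ⊕-identityˡ 0ₙ ⟩
    0ₙ             ∎
    where open ≡-Reasoning

  suc-mod : ∀ y → suc (toℕ y) mod p ≡ y ⊕ 1ₙ
  suc-mod y = begin
    suc (toℕ y) mod p      ≡⟨ cong (_mod p) (+-comm 1 (toℕ y)) ⟩
    (toℕ y + 1) mod p      ≡⟨ mod-+ (toℕ y) 1 ⟨
    (toℕ y mod p) ⊕ 1ₙ     ≡⟨ cong (_⊕ 1ₙ) (mod-toℕ y) ⟩
    y ⊕ 1ₙ                 ∎
    where open ≡-Reasoning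

  -- Adding 1 wraps around only when the result is zero.
  toℕ-⊕1 : ∀ {x y} → y ⊕ 1ₙ ≡ x → x ≢ 0ₙ → suc (toℕ y) ≡ toℕ x
  toℕ-⊕1 {x} {y} y⊕1≡x x≢0 with m≤n⇒m<n∨m≡n (toℕ<n y)
  ... | inj₁ 1+y<p = begin
      suc (toℕ y)              ≡⟨ m<n⇒m%n≡m 1+y<p ⟨
      suc (toℕ y) % p          ≡⟨ toℕ-mod (suc (toℕ y)) ⟨
      toℕ (suc (toℕ y) mod p)  ≡⟨ cong toℕ (trans (suc-mod y) y⊕1≡x) ⟩
      toℕ x                    ∎
    where open ≡-Reasoning
  ... | inj₂ 1+y≡p = contradiction (begin
      x                        ≡⟨ trans (suc-mod y) y⊕1≡x ⟨
      suc (toℕ y) mod p        ≡⟨ cong (_mod p) 1+y≡p ⟩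
      p mod p                  ≡⟨ mod-cong ([m+n]%n≡m%n 0 p) ⟩
      0ₙ                       ∎) x≢0
    where open ≡-Reasoning

  -- Legal steps as parabola moves.

  para : Fin p → G
  para x = x , x ⊗ x

  para-0 : para 0ₙ ≡ 0ᴳ
  para-0 = cong (0ₙ ,_) (zeroʳ 0ₙ)

  _≟ᴳ_ : DecidableEquality G
  _≟ᴳ_ = ≡-dec _≟_ _≟_

  open Game (Cay G-isAbelianGroup S₂)

  -- Staying put is the move `para 0ₙ`, so this one form covers both alternatives of `Step`.
  Reach : G → G → Set
  Reach u v = ∃[ x ] v ≡ u +ᴳ para x

  reach? : ∀ u v → Dec (Reach u v)
  reach? u v = any? (λ x → v ≟ᴳ (u +ᴳ para x))

  u+[v-u]≡v : ∀ u v → u +ᴳ (v - u) ≡ v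
  u+[v-u]≡v u v = trans (𝔾.comm u (v - u)) (𝔾.//-rightDividesˡ u v)

  [u+d]-u≡d : ∀ u d → (u +ᴳ d) - u ≡ d
  [u+d]-u≡d = 𝔾.xyx⁻¹≈y

  Reach-refl : ∀ u → Reach u u
  Reach-refl u = 0ₙ , sym (trans (cong (u +ᴳ_) para-0) (𝔾.identityʳ u))

  Step⇒Reach : ∀ {u v} → Step u v → Reach u v
  Step⇒Reach {u} (inj₁ refl) = Reach-refl u
  Step⇒Reach {u} {v} (inj₂ (x , eq)) = x , trans (sym (u+[v-u]≡v u v)) (cong (u +ᴳ_) eq)

  Reach⇒Step : ∀ {u v} → Reach u v → Step u v
  Reach⇒Step {u} (x , refl) = inj₂ (x , [u+d]-u≡d u (para x))

  -- Fewer than p cops lose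

  -- Seen from the cop, its own targets form the parabola and the robber's form the translate by
  -- `r - c`; a common target is an intersection point.
  meet : ∀ {c r x} → Reach c (r +ᴳ para x) →
         let (a , b) = r - c in a ⊗ a ⊕ a ⊗ (x ⊕ x) ≡ b
  meet {c} {r} {x} (y , eq) =
    translate-meets-parabola {proj₁ (r - c)} {proj₂ (r - c)} {x}
      (trans (cong (λ z → z ⊗ z) (cong proj₁ eq′)) (sym (cong proj₂ eq′)))
    where
    eq′ : (r - c) +ᴳ para x ≡ para y
    eq′ = 𝔾.∙-cancelˡ c _ _ (begin
      c +ᴳ ((r - c) +ᴳ para x)  ≡⟨ 𝔾.assoc c (r - c) (para x) ⟨
      (c +ᴳ (r - c)) +ᴳ para x  ≡⟨ cong (_+ᴳ para x) (u+[v-u]≡v c r) ⟩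
      r +ᴳ para x               ≡⟨ eq ⟩
      c +ᴳ para y               ∎)
      where open ≡-Reasoning

  -- If the gap has nonzero first coordinate `a`, then `meet` is linear in `x` with invertible slope
  -- `2a`. If `a` is zero, `meet` forces the second coordinate to vanish as well, putting the cop on
  -- the robber.
  block-unique : ∀ {c r x x′} → c ≢ r → Reach c (r +ᴳ para x) → Reach c (r +ᴳ para x′) → x ≡ x′
  block-unique {c} {r} {x} {x′} c≢r reach reach′ with proj₁ (r - c) ≟ 0ₙ
  ... | no a≢0 = begin
      x              ≡⟨ ½⊗[x⊕x]≡x x ⟨
      ½ ⊗ (x ⊕ x)    ≡⟨ cong (½ ⊗_) (⊗-cancelˡ a≢0 (⊕-cancelˡ _ _ _
                          (trans (meet reach) (sym (meet reach′))))) ⟩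
      ½ ⊗ (x′ ⊕ x′)  ≡⟨ ½⊗[x⊕x]≡x x′ ⟩
      x′             ∎
    where open ≡-Reasoning
  ... | yes a≡0 = contradiction (sym (𝔾.x∙y⁻¹≈ε⇒x≈y r c (cong₂ _,_ a≡0 b≡0))) c≢r
    where
    open ≡-Reasoning
    b≡0 : proj₂ (r - c) ≡ 0ₙ
    b≡0 = begin
      proj₂ (r - c)               ≡⟨ meet reach ⟨
      _                           ≡⟨ cong (λ a → a ⊗ a ⊕ a ⊗ (x ⊕ x)) a≡0 ⟩
      0ₙ ⊗ 0ₙ ⊕ 0ₙ ⊗ (x ⊕ x)      ≡⟨ cong₂ _⊕_ (zeroˡ 0ₙ) (zeroˡ (x ⊕ x)) ⟩
      0ₙ ⊕ 0ₙ                     ≡⟨ ⊕-identityˡ 0ₙ ⟩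
      0ₙ                          ∎

  Free : ∀ {m} → (Fin m → G) → G → Set
  Free c r = ∀ i → ¬ Reach (c i) r

  -- The robber looks only at the vertical line through the origin: a cop's first coordinate
  -- determines its move onto that line, so each cop threatens at most one of the `p` points.
  placement : ∀ {m} → m < p → (c : Fin m → G) → ∃[ r ] Free c r
  placement m<p c =
    let b , free = unblocked m<p (λ b i → Reach (c i) (0ₙ , b)) (λ b i → reach? (c i) (0ₙ , b)) unique
    in (0ₙ , b) , free
    where
    unique : ∀ {b b′} i → Reach (c i) (0ₙ , b) → Reach (c i) (0ₙ , b′) → b ≡ b′
    unique i (x , eq) (x′ , eq′)
      with refl ← ⊕-cancelˡ (proj₁ (c i)) x x′ (trans (sym (cong proj₁ eq)) (cong proj₁ eq′))
      = trans (cong proj₂ eq) (sym (cong proj₂ eq′))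

  escape : ∀ {m} → m < p → (c : Fin m → G) (r : G) → (∀ i → c i ≢ r) → ∃[ x ] Free c (r +ᴳ para x)
  escape m<p c r c≢r = unblocked m<p (λ x i → Reach (c i) (r +ᴳ para x))
    (λ x i → reach? (c i) (r +ᴳ para x)) (λ i → block-unique (c≢r i))

  module Evasion {m} (m<p : m < p) (σ : CopStrategy m) where
    open CopStrategy σ

    -- The invariant after each robber placement or turn. Since `Reach` is reflexive, `Free`
    -- excludes capture both now and at the next cop turn.
    State : Set
    State = ∃[ h ] ∃[ r ] Free (position h) r

    uncaught : ∀ {h r} → Free (position h) r → ∀ i → position (r ∷ h) i ≢ r
    uncaught {h} {r} free i eq = free i (subst (Reach _) eq (Step⇒Reach (legal h r i)))

    next : State → State
    next (h , r , free) with x , free′ ← escape m<p (position (r ∷ h)) r (uncaught free)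
      = r ∷ h , r +ᴳ para x , free′

    next-reach : ∀ s → Reach (proj₁ (proj₂ s)) (proj₁ (proj₂ (next s)))
    next-reach (h , r , free) = _ , refl

    state : ℕ → State
    state zero    = [] , placement m<p (position [])
    state (suc t) = next (state t)

    play : ℕ → G
    play t = proj₁ (proj₂ (state t))

    play-legal : RobberPlay play
    play-legal t = Reach⇒Step (next-reach (state t))

    seen-play : ∀ t → seen play t ≡ proj₁ (state t)
    seen-play zero    = refl
    seen-play (suc t) = cong (play t ∷_) (seen-play t)

    play-free : ∀ t → Free (position (seen play t)) (play t)
    play-free t = subst (λ h → Free (position h) (play t)) (sym (seen-play t)) (proj₂ (proj₂ (state t)))

    play-evades : ¬ Captures σ play
    play-evades (t , i , inj₁ eq) = play-free t i (subst (Reach _) eq (Reach-refl _))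
    play-evades (t , i , inj₂ eq) = uncaught (play-free t) i eq

  p≤copNumber : ∀ m → CopsWin m → p ≤ m
  p≤copNumber m (σ , wins) = ≮⇒≥ λ m<p →
    let open Evasion m<p σ in play-evades (wins play play-legal)

  -- p cops win

  -- How many times 2 must be subtracted from `C` to reach zero.
  κ : Fin p → ℕ
  κ C = toℕ (½ ⊗ C)

  -- Halving turns subtraction of 2 into subtraction of 1, which does not wrap around at a nonzero
  -- value.
  κ-⊝2 : ∀ {C C′} → (C′ ⊕ 1ₙ) ⊕ 1ₙ ≡ C → C ≢ 0ₙ → suc (κ C′) ≡ κ C
  κ-⊝2 {C} {C′} eq C≢0 = toℕ-⊕1 (begin
    ½ ⊗ C′ ⊕ 1ₙ               ≡⟨ cong (½ ⊗ C′ ⊕_) (½⊗[x⊕x]≡x 1ₙ) ⟨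
    ½ ⊗ C′ ⊕ ½ ⊗ (1ₙ ⊕ 1ₙ)    ≡⟨ ⊗-distribˡ-⊕ ½ C′ (1ₙ ⊕ 1ₙ) ⟨
    ½ ⊗ (C′ ⊕ (1ₙ ⊕ 1ₙ))      ≡⟨ cong (½ ⊗_) (trans (sym (⊕-assoc C′ 1ₙ 1ₙ)) eq) ⟩
    ½ ⊗ C                     ∎) (C≢0 ∘ ½⊗x≡0⇒x≡0)
    where open ≡-Reasoning

  -- The step `u` planned in sheared coordinates: return to `A = 0`, then alternate between 0 and 1.
  -- Each round trip lowers `C` by `1 + 1 = 2`, so `C` eventually reaches zero.
  shift : Fin p → Fin p
  shift A with A ≟ 0ₙ
  ... | yes _ = 1ₙ
  ... | no _  = ⊖ A

  -- The number of steps (A , C) ↦ (A + shift A , C - (shift A)²) needed to reach (0 , 0).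
  rank : Fin p → Fin p → ℕ
  rank A C with A ≟ 0ₙ
  ... | yes _ = 2 * κ C
  ... | no _  = suc (2 * κ (C ⊝ A ⊗ A))

  rank-0 : ∀ C → rank 0ₙ C ≡ 2 * κ C
  rank-0 C with 0ₙ ≟ 0ₙ
  ... | yes _  = refl
  ... | no 0≢0 = contradiction refl 0≢0

  rank-1 : ∀ C → rank 1ₙ C ≡ suc (2 * κ (C ⊝ 1ₙ))
  rank-1 C with 1ₙ ≟ 0ₙ
  ... | yes 1≡0 = contradiction 1≡0 1ₙ≢0ₙ
  ... | no _    = cong (λ z → suc (2 * κ (C ⊝ z))) (⊗-identityˡ 1ₙ)

  x⊕y≡z⇒x≡z⊝y : ∀ {x y z} → x ⊕ y ≡ z → x ≡ z ⊝ y
  x⊕y≡z⇒x≡z⊝y {x} {y} refl = sym (ℤₚ.//-rightDividesʳ y x)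

  rank-decreases : ∀ {A C A′ C′} → (A , C) ≢ (0ₙ , 0ₙ) → A′ ≡ A ⊕ shift A → C′ ⊕ (shift A ⊗ shift A) ≡ C →
                   rank A′ C′ < rank A C
  rank-decreases {A} {C} {A′} {C′} ≢0 A′≡ C′≡ with A ≟ 0ₙ
  ... | no A≢0 = ≤-reflexive (cong suc (begin
      rank A′ C′         ≡⟨ cong (λ a → rank a C′) (trans A′≡ (⊖-inverseʳ A)) ⟩
      rank 0ₙ C′         ≡⟨ rank-0 C′ ⟩
      2 * κ C′           ≡⟨ cong (λ z → 2 * κ z) (x⊕y≡z⇒x≡z⊝y
                              (trans (cong (C′ ⊕_) (sym (-x*-x≡x*x A))) C′≡)) ⟩
      2 * κ (C ⊝ A ⊗ A)  ∎))
    where open ≡-Reasoning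
  ... | yes refl = ≤-reflexive (begin
      suc (rank A′ C′)               ≡⟨ cong (λ a → suc (rank a C′)) (trans A′≡ (⊕-identityˡ 1ₙ)) ⟩
      suc (rank 1ₙ C′)               ≡⟨ cong suc (rank-1 C′) ⟩
      suc (suc (2 * κ (C′ ⊝ 1ₙ)))    ≡⟨ *-suc 2 (κ (C′ ⊝ 1ₙ)) ⟨
      -- The step out to `A = 1` lowers `C` by 1, and `rank-1` already accounts for the 1 lost on
      -- the way back; together they lower `κ` by one, which is worth two steps.
      2 * suc (κ (C′ ⊝ 1ₙ))          ≡⟨ cong (2 *_) (κ-⊝2 C″⊕2≡C (≢0 ∘ cong (0ₙ ,_))) ⟩
      2 * κ C                        ∎)
    where
    open ≡-Reasoning
    C″⊕2≡C : ((C′ ⊝ 1ₙ) ⊕ 1ₙ) ⊕ 1ₙ ≡ C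
    C″⊕2≡C = begin
      ((C′ ⊝ 1ₙ) ⊕ 1ₙ) ⊕ 1ₙ  ≡⟨ cong (_⊕ 1ₙ) (ℤₚ.//-rightDividesˡ 1ₙ C′) ⟩
      C′ ⊕ 1ₙ                ≡⟨ cong (C′ ⊕_) (⊗-identityˡ 1ₙ) ⟨
      C′ ⊕ 1ₙ ⊗ 1ₙ           ≡⟨ C′≡ ⟩
      C                      ∎

  shear : Fin p → G → Fin p
  shear i (A , B) = B ⊝ (A ⊕ A) ⊗ i

  -- Bounds how many more times the robber can play `para i` before cop `i` catches it.
  distance : Fin p → G → ℕ
  distance i d = rank (proj₁ d) (shear i d)

  reply : Fin p → G → Fin p → Fin p
  reply i d a with a ≟ i
  -- The `y` with `y ⊕ u ≡ i` required by `sheared-step`, for `u` the planned shift.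
  ... | yes _ = i ⊝ shift (proj₁ d)
  ... | no _  = a

  reply-≢ : ∀ {i d a} → a ≢ i → reply i d a ≡ a
  reply-≢ {i} {d} {a} a≢i with a ≟ i
  ... | yes a≡i = contradiction a≡i a≢i
  ... | no _    = refl

  reply-≡ : ∀ i d → reply i d i ⊕ shift (proj₁ d) ≡ i
  reply-≡ i d with i ≟ i
  ... | yes _  = ℤₚ.//-rightDividesˡ (shift (proj₁ d)) i
  ... | no i≢i = contradiction refl i≢i

  -- On the first cop turn no robber move has been seen yet, so every cop stays. Later each cop
  -- answers the latest robber move, whose parameter is the first coordinate of `r - r′`.
  pursuit : List G → Fin p → G
  pursuit []           i = 0ᴳ
  pursuit (r ∷ [])     i = 0ᴳ
  pursuit (r ∷ r′ ∷ h) i = pursuit (r′ ∷ h) i +ᴳ para (reply i (r′ - pursuit (r′ ∷ h) i) (proj₁ (r - r′)))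

  pursuit-strategy : CopStrategy p
  pursuit-strategy = record { position = pursuit ; legal = legal }
    where
    legal : ∀ h r i → Step (pursuit h i) (pursuit (r ∷ h) i)
    legal []       r i = inj₁ refl
    legal (r′ ∷ h) r i = Reach⇒Step (_ , refl)

  copied-move : ∀ c r s → (r +ᴳ s) - (c +ᴳ s) ≡ r - c
  copied-move c r s = begin
    (r +ᴳ s) - (c +ᴳ s)                 ≡⟨ cong (λ v → (v +ᴳ s) - (c +ᴳ s)) (u+[v-u]≡v c r) ⟨
    ((c +ᴳ (r - c)) +ᴳ s) - (c +ᴳ s)    ≡⟨ cong (_- (c +ᴳ s)) (𝔾.xy∙z≈xz∙y c (r - c) s) ⟩
    ((c +ᴳ s) +ᴳ (r - c)) - (c +ᴳ s)    ≡⟨ [u+d]-u≡d (c +ᴳ s) (r - c) ⟩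
    r - c                               ∎
    where open ≡-Reasoning

  own-move-decreases : ∀ c r i → r - c ≢ 0ᴳ →
    distance i ((r +ᴳ para i) - (c +ᴳ para (reply i (r - c) i))) < distance i (r - c)
  own-move-decreases c r i d≢0 = uncurry (rank-decreases sheared≢0)
    (sheared-step {proj₁ c} {proj₂ c} {A = proj₁ d} {A′ = proj₁ d′} {y = reply i d i} {u = shift (proj₁ d)}
                  (cong proj₁ cop+gap) (cong proj₂ cop+gap) (unshear d)
                  (cong proj₁ cop+gap′) (cong proj₂ cop+gap′) (unshear d′) (reply-≡ i d))
    where
    d d′ : G
    d  = r - c
    d′ = (r +ᴳ para i) - (c +ᴳ para (reply i d i))

    cop+gap : c +ᴳ d ≡ r
    cop+gap = u+[v-u]≡v c r

    cop+gap′ : (c +ᴳ para (reply i d i)) +ᴳ d′ ≡ r +ᴳ para i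
    cop+gap′ = u+[v-u]≡v _ (r +ᴳ para i)

    unshear : ∀ e → shear i e ⊕ (proj₁ e ⊕ proj₁ e) ⊗ i ≡ proj₂ e
    unshear (A , B) = ℤₚ.//-rightDividesˡ ((A ⊕ A) ⊗ i) B

    -- The shear is invertible and fixes zero, so only a zero gap has zero sheared coordinates.
    sheared≢0 : (proj₁ d , shear i d) ≢ (0ₙ , 0ₙ)
    sheared≢0 eq = d≢0 (cong₂ _,_ A≡0 (begin
      proj₂ d                                ≡⟨ unshear d ⟨
      shear i d ⊕ (proj₁ d ⊕ proj₁ d) ⊗ i    ≡⟨ cong₂ (λ C A → C ⊕ (A ⊕ A) ⊗ i) (cong proj₂ eq) A≡0 ⟩
      0ₙ ⊕ (0ₙ ⊕ 0ₙ) ⊗ i                     ≡⟨ ⊕-identityˡ _ ⟩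
      (0ₙ ⊕ 0ₙ) ⊗ i                          ≡⟨ cong (_⊗ i) (⊕-identityˡ 0ₙ) ⟩
      0ₙ ⊗ i                                 ≡⟨ zeroˡ i ⟩
      0ₙ                                     ∎))
      where
      open ≡-Reasoning
      A≡0 : proj₁ d ≡ 0ₙ
      A≡0 = cong proj₁ eq

  module Pursuit (r : ℕ → G) (legal : RobberPlay r) where

    -- Measured after the cops have responded to `r t`, so a zero gap is the second alternative of
    -- `Captures`.
    gap : ℕ → Fin p → G
    gap t i = r t - pursuit (seen r (suc t)) i

    potential : ℕ → ℕ
    potential t = sum +-0-rawMonoid (λ i → distance i (gap t i))

    move : ∀ t → ∃[ a ] r (suc t) ≡ r t +ᴳ para a
    move t = Step⇒Reach (legal t)

    gap-suc : ∀ t i → let a = proj₁ (move t) in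
      gap (suc t) i ≡ (r t +ᴳ para a) - (pursuit (seen r (suc t)) i +ᴳ para (reply i (gap t i) a))
    gap-suc t i with a , eq ← move t = cong₂ (λ v b → v - (pursuit (seen r (suc t)) i +ᴳ para (reply i (gap t i) b)))
      eq (cong proj₁ (trans (cong (_- r t) eq) ([u+d]-u≡d (r t) (para a))))

    distance-< : ∀ t i → gap t i ≢ 0ᴳ → i ≡ proj₁ (move t) → distance i (gap (suc t) i) < distance i (gap t i)
    distance-< t i d≢0 refl = subst (λ d → distance i d < distance i (gap t i)) (sym (gap-suc t i))
      (own-move-decreases (pursuit (seen r (suc t)) i) (r t) i d≢0)

    distance-≤ : ∀ t i → gap t i ≢ 0ᴳ → distance i (gap (suc t) i) ≤ distance i (gap t i)
    distance-≤ t i d≢0 with proj₁ (move t) ≟ i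
    ... | yes a≡i = <⇒≤ (distance-< t i d≢0 (sym a≡i))
    ... | no a≢i  = ≤-reflexive (cong (distance i) (begin
        gap (suc t) i                                                  ≡⟨ gap-suc t i ⟩
        (r t +ᴳ para a) - (c +ᴳ para (reply i (gap t i) a))            ≡⟨ cong (λ b → (r t +ᴳ para a) - (c +ᴳ para b)) (reply-≢ a≢i) ⟩
        (r t +ᴳ para a) - (c +ᴳ para a)                                ≡⟨ copied-move c (r t) (para a) ⟩
        gap t i                                                        ∎))
      where
      open ≡-Reasoning
      a = proj₁ (move t)
      c = pursuit (seen r (suc t)) i

    -- Every robber move, including staying put, is `para i` for some cop `i`. That cop's distance
    -- drops and no other grows, so the potential falls on each turn without capture; `n` bounds the
    -- recursion.
    captures-within : ∀ n t → potential t < n → Captures pursuit-strategy r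
    captures-within (suc n) t bound with any? (λ i → gap t i ≟ᴳ 0ᴳ)
    ... | yes (i , d≡0) = t , i , inj₂ (sym (𝔾.x∙y⁻¹≈ε⇒x≈y (r t) _ d≡0))
    ... | no ∄caught    = captures-within n (suc t) (<-≤-trans
          (sum-mono-< (λ i → distance-≤ t i (λ d≡0 → ∄caught (i , d≡0))) (proj₁ (move t))
            (distance-< t _ (λ d≡0 → ∄caught (_ , d≡0)) refl))
          (s≤s⁻¹ bound))

    captures : Captures pursuit-strategy r
    captures = captures-within _ 0 (n<1+n (potential 0))

  p-cops-win : CopsWin p
  p-cops-win = pursuit-strategy , Pursuit.captures

  -- Cardinalities of the connection set and the group.

  |S₂|≡p : HasCardinality S₂ p
  |S₂|≡p = para , cong proj₁ , λ g → mk⇔ (λ (x , eq) → x , sym eq) (λ (x , eq) → x , sym eq)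

  -- The squared form of `p = √|G|`.
  |G|≡p² : HasCardinality {A = G} U (p ^ 2)
  |G|≡p² = subst (HasCardinality U) (cong (p *_) (sym (*-identityʳ p)))
    ( remQuot p
    , (λ {i} {j} eq → trans (sym (combine-remQuot {p} p i)) (trans (cong (uncurry combine) eq) (combine-remQuot {p} p j)))
    , λ (x , y) → mk⇔ (λ _ → combine x y , remQuot-combine x y) _)

theorem5p2 : (p : ℕ) (pr : Prime p) → p > 3 →
    let open ℤMod p {{prime⇒nonZero pr}} in
    IsCopNumber (Cay G-isAbelianGroup S₂) p
    × HasCardinality S₂ p
    × HasCardinality {A = G} U (p ^ 2)
theorem5p2 p pr p>3 = (p-cops-win , p≤copNumber) , |S₂|≡p , |G|≡p²
  where open OddPrime p pr p>3
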